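{- For all integers $n \ge 1$ and $r,s\ge 0$, one has in $R_n$ the identity $F_{1^r}F_{1^s}=a_{r,s}F_{1^{r+s}}$, where $$a_{r,s}=\begin{cases}0 & \text{if } r \text{ and } s \text{ are both odd},\\[4pt] \displaystyle\binom{\lfloor \frac{r+s}{2}\rfloor}{\lfloor \frac{r}{2}\rfloor} & \text{otherwise.}\end{cases}$$
   Context: Let $R_n=\mathbb{Q}[\theta_1,\dots,\theta_n]$ be the polynomial ring in anticommuting variables over $\mathbb{Q}$ (the exterior algebra on $n$ generators): $\theta_i\theta_j=-\theta_j\theta_i$ for $i\ne j$ and $\theta_i^2=0$. For $A=\{a_1<\cdots<a_r\}\subseteq [n]=\{1,\dots,n\}$ put $\theta_A=\theta_{a_1}\cdots\theta_{a_r}$; these form a basis of $R_n$. For $r\ge 0$ define $F_{1^r}=F_{1^r}(\theta_1,\dots,\theta_n)=\sum_{A\subseteq[n],\,|A|=r}\theta_A$ (so $F_{1^0}=1$ and $F_{1^r}=0$ if $r>n$). -}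

module Defs where

open import Algebra.Bundles using (Ring)
open import Data.Fin.Base using (Fin)
open import Data.Fin.Subset using (Subset; inside; outside; ∣_∣)
open import Data.Fin.Subset.Properties using (_∈?_)
open import Data.Integer.Base using (+_)
open import Data.List.Base using (List; []; _∷_; _++_; map; filter; foldr; allFin)
open import Data.Nat.Base as ℕ using (ℕ; zero; suc; ⌊_/2⌋)
open import Data.Nat.Combinatorics using (_C_)
open import Data.Parity.Base using (Parity; 1ℙ)
open import Data.Product.Base using (_,_)
open import Data.Rational.Base as ℚ using (ℚ; 0ℚ; 1ℚ)
import Data.Nat.Properties as ℕ
import Data.Vec.Base as Vec
open import Level using (0ℓ)
open import Relation.Binary.PropositionalEquality using (_≢_)

-- The ring R_n is the unital associative ℚ-algebra presented by generators θ i
-- and the exterior relations. Its elements are represented by expressions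
-- `Expr n`, taken up to the least ℚ-algebra congruence `_≈_` that contains
-- `θ-anticomm` and `θ-square`.

infixl 7 _*_
infixl 6 _+_
infix  8 -_

data Expr (n : ℕ) : Set where
  con     : ℚ → Expr n
  θ       : Fin n → Expr n
  _+_ _*_ : Expr n → Expr n → Expr n
  -_      : Expr n → Expr n

infix 4 _≈_

data _≈_ {n : ℕ} : Expr n → Expr n → Set where
  ≈-refl  : ∀ {x} → x ≈ x
  ≈-sym   : ∀ {x y} → x ≈ y → y ≈ x
  ≈-trans : ∀ {x y z} → x ≈ y → y ≈ z → x ≈ z

  +-cong  : ∀ {x x′ y y′} → x ≈ x′ → y ≈ y′ → x + y ≈ x′ + y′
  *-cong  : ∀ {x x′ y y′} → x ≈ x′ → y ≈ y′ → x * y ≈ x′ * y′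
  -‿cong  : ∀ {x x′} → x ≈ x′ → - x ≈ - x′

  +-assoc     : ∀ x y z → (x + y) + z ≈ x + (y + z)
  +-comm      : ∀ x y → x + y ≈ y + x
  +-identityˡ : ∀ x → con 0ℚ + x ≈ x
  -‿inverseˡ  : ∀ x → - x + x ≈ con 0ℚ

  *-assoc     : ∀ x y z → (x * y) * z ≈ x * (y * z)
  *-identityˡ : ∀ x → con 1ℚ * x ≈ x
  distribˡ    : ∀ x y z → x * (y + z) ≈ x * y + x * z
  distribʳ    : ∀ x y z → (y + z) * x ≈ y * x + z * x

  con-+       : ∀ p q → con (p ℚ.+ q) ≈ con p + con q
  con-*       : ∀ p q → con (p ℚ.* q) ≈ con p * con q
  con-central : ∀ p x → con p * x ≈ x * con p

  θ-anticomm  : ∀ {i j} → i ≢ j → θ i * θ j ≈ - (θ j * θ i)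
  θ-square    : ∀ i → θ i * θ i ≈ con 0ℚ

R : ℕ → Ring 0ℓ 0ℓ
R n = record
  { Carrier = Expr n
  ; _≈_     = _≈_
  ; _+_     = _+_
  ; _*_     = _*_
  ; -_      = -_
  ; 0#      = con 0ℚ
  ; 1#      = con 1ℚ
  ; isRing  = record
    { +-isAbelianGroup = record
      { isGroup = record
        { isMonoid = record
          { isSemigroup = record
            { isMagma = record
              { isEquivalence = record { refl = ≈-refl ; sym = ≈-sym ; trans = ≈-trans }
              ; ∙-cong        = +-cong
              }
            ; assoc   = +-assoc
            }
          ; identity = +-identityˡ , λ x → ≈-trans (+-comm x _) (+-identityˡ x)
          }
        ; inverse = -‿inverseˡ , λ x → ≈-trans (+-comm x _) (-‿inverseˡ x)
        ; ⁻¹-cong = -‿cong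
        }
      ; comm = +-comm
      }
    ; *-cong     = *-cong
    ; *-assoc    = *-assoc
    ; *-identity = *-identityˡ , λ x → ≈-trans (≈-sym (con-central 1ℚ x)) (*-identityˡ x)
    ; distrib    = distribˡ , distribʳ
    }
  }

sum product : ∀ {n} → List (Expr n) → Expr n
sum     = foldr _+_ (con 0ℚ)
product = foldr _*_ (con 1ℚ)

-- `allFin n` is increasing, so the factors appear in the order a₁ < ⋯ < a_r.
θ[_] : ∀ {n} → Subset n → Expr n
θ[_] {n} A = product (map θ (filter (_∈? A) (allFin n)))

-- Every subset of an n-element set, each listed exactly once.
subsets : ∀ n → List (Subset n)
subsets zero    = Vec.[] ∷ []
subsets (suc n) = map (inside Vec.∷_) (subsets n) ++ map (outside Vec.∷_) (subsets n)

F : ∀ n → ℕ → Expr n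
F n r = sum (map θ[_] (filter (λ A → ∣ A ∣ ℕ.≟ r) (subsets n)))

a : ℕ → ℕ → ℕ
a r s with ℕ.parity r | ℕ.parity s
... | 1ℙ | 1ℙ = 0
... | _  | _  = ⌊ r ℕ.+ s /2⌋ C ⌊ r /2⌋

fromℕ : ∀ {n} → ℕ → Expr n
fromℕ k = con (+ k ℚ./ 1)

{-# OPTIONS --safe #-}

-- Induction on n. Splitting off x = θ₁ gives F_{r+1} = x F′_r + F′_{r+1}, where
-- F′ is built from the remaining generators. In F_{r+1} F_{s+1} the term
-- x F′_r x F′_s vanishes, since x² = 0 and x commutes with F′_r up to sign; the
-- rest reduces the identity to the signed Pascal rule
--   a r (s+1) + (-1)^{r+1} a (r+1) s = a (r+1) (s+1).
module Submission where

open import Defs using (R; F; a; fromℕ)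
open import Algebra.Bundles using (Ring)
open import Data.Nat.Base as ℕ using (ℕ)

open import Defs using (Expr; con; con-+; θ; θ-anticomm; θ-square; subsets; sum; product)
import Algebra.Properties.CommutativeMonoid.Mult as CommutativeMonoidMult
import Algebra.Properties.Ring as RingProperties
import Algebra.Properties.Semiring.Mult as SemiringMult
import Data.Integer.Properties as ℤ
import Data.Nat.Properties as ℕ
import Data.Rational.Base as ℚ
import Data.Rational.Properties as ℚ
import Data.Vec.Base as Vec
import Relation.Binary.Reasoning.Setoid as SetoidReasoning
open import Data.Fin.Base using (Fin; zero; suc)
open import Data.Fin.Properties using (suc-injective)
open import Data.Fin.Subset using (Subset; inside; outside; ∣_∣)
open import Data.Fin.Subset.Properties using (_∈?_; drop-there)
open import Data.Integer.Base as ℤ using (+_)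
open import Data.List.Base using (List; []; _∷_; _++_; map; filter; tabulate; allFin)
open import Data.List.Properties
  using (filter-++; filter-≐; filter-none; map-++; map-cong; map-∘; map-tabulate)
open import Data.List.Relation.Unary.All using (universal)
open import Data.Nat.Base using (zero; suc; ⌊_/2⌋)
open import Data.Nat.Combinatorics using (_C_; nCn≡1; nCk+nC[k+1]≡[n+1]C[k+1])
open import Data.Nat.Coprimality using (1-coprimeTo) renaming (sym to coprime-sym)
open import Data.Parity.Base using (0ℙ; 1ℙ)
open import Data.Product.Base using (_,_)
open import Data.Vec.Base using (here; there)
open import Function.Base using (_∘_; id)
open import Relation.Binary.PropositionalEquality as ≡
  using (_≡_; _≢_; refl; cong; cong₂; trans)
open import Relation.Nullary using (yes; no)
open import Relation.Unary using (Pred; Decidable)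

-- Parity and the values of `a`.

data EvenOdd : ℕ → Set where
  even : ∀ k → EvenOdd (k ℕ.* 2)
  odd  : ∀ k → EvenOdd (suc (k ℕ.* 2))

evenOdd : ∀ n → EvenOdd n
evenOdd zero    = even 0
evenOdd (suc n) with evenOdd n
... | even k = odd k
... | odd k  = even (suc k)

-- `suc k ℕ.* 2` unfolds to two successors over `k ℕ.* 2`, and both parity and halving recurse in
-- steps of two; hence the doubled form in `EvenOdd`.
parity-even : ∀ k → ℕ.parity (k ℕ.* 2) ≡ 0ℙ
parity-even zero    = refl
parity-even (suc k) = parity-even k

parity-odd : ∀ k → ℕ.parity (suc (k ℕ.* 2)) ≡ 1ℙ
parity-odd zero    = refl
parity-odd (suc k) = parity-odd k

⌊k*2+m/2⌋ : ∀ k m → ⌊ k ℕ.* 2 ℕ.+ m /2⌋ ≡ k ℕ.+ ⌊ m /2⌋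
⌊k*2+m/2⌋ zero    m = refl
⌊k*2+m/2⌋ (suc k) m = cong suc (⌊k*2+m/2⌋ k m)

⌊k*2/2⌋ : ∀ k → ⌊ k ℕ.* 2 /2⌋ ≡ k
⌊k*2/2⌋ zero    = refl
⌊k*2/2⌋ (suc k) = cong suc (⌊k*2/2⌋ k)

⌊1+k*2/2⌋ : ∀ k → ⌊ suc (k ℕ.* 2) /2⌋ ≡ k
⌊1+k*2/2⌋ zero    = refl
⌊1+k*2/2⌋ (suc k) = cong suc (⌊1+k*2/2⌋ k)

-- An even first argument already excludes the zero case of `a`, so the parity of `s` stays
-- undecided.
a-even : ∀ k s → a (k ℕ.* 2) s ≡ (k ℕ.+ ⌊ s /2⌋) C k
a-even k s rewrite parity-even k = cong₂ _C_ (⌊k*2+m/2⌋ k s) (⌊k*2/2⌋ k)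

a-even-even : ∀ k l → a (k ℕ.* 2) (l ℕ.* 2) ≡ (k ℕ.+ l) C k
a-even-even k l = trans (a-even k (l ℕ.* 2)) (cong (λ m → (k ℕ.+ m) C k) (⌊k*2/2⌋ l))

a-even-odd : ∀ k l → a (k ℕ.* 2) (suc (l ℕ.* 2)) ≡ (k ℕ.+ l) C k
a-even-odd k l = trans (a-even k (suc (l ℕ.* 2))) (cong (λ m → (k ℕ.+ m) C k) (⌊1+k*2/2⌋ l))

a-odd-even : ∀ k l → a (suc (k ℕ.* 2)) (l ℕ.* 2) ≡ (k ℕ.+ l) C k
a-odd-even k l rewrite parity-odd k | parity-even l =
  -- The outer successor is moved onto the second summand, so that the first one is even and can be
  -- pulled out of the half.
  cong₂ _C_ (trans (cong ⌊_/2⌋ (≡.sym (ℕ.+-suc (k ℕ.* 2) (l ℕ.* 2))))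
            (trans (⌊k*2+m/2⌋ k (suc (l ℕ.* 2))) (cong (k ℕ.+_) (⌊1+k*2/2⌋ l))))
            (⌊1+k*2/2⌋ k)

a-odd-odd : ∀ k l → a (suc (k ℕ.* 2)) (suc (l ℕ.* 2)) ≡ 0
a-odd-odd k l rewrite parity-odd k | parity-odd l = refl

a-zeroʳ : ∀ r → a r 0 ≡ 1
a-zeroʳ r with evenOdd r
... | even k = trans (a-even-even k 0) (trans (cong (_C k) (ℕ.+-identityʳ k)) (nCn≡1 k))
... | odd k  = trans (a-odd-even k 0) (trans (cong (_C k) (ℕ.+-identityʳ k)) (nCn≡1 k))

-- Elementary symmetric polynomials of anticommuting elements of a ring.

module ElementarySymmetric {c ℓ} (𝓡 : Ring c ℓ) where
  open Ring 𝓡 hiding (zero) renaming (_*_ to _·_; refl to ≈-refl; sym to ≈-sym; trans to ≈-trans)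
  open RingProperties 𝓡 using (-‿distribˡ-*; -‿distribʳ-*; -0#≈0#; -‿involutive; -‿+-comm)
  open SemiringMult semiring
    using (_×_; ×-congˡ; ×-homo-1; ×-homo-+; ×-comm-*)
  open CommutativeMonoidMult +-commutativeMonoid using (×-distrib-+)
  open SetoidReasoning setoid

  -- The elementary symmetric polynomial of degree r, with factors in increasing order of index.
  -- Taking a family in a fixed ring keeps the tail `xs ∘ suc` in that ring, so induction on n never
  -- changes the ring.
  e : ∀ {n} → (Fin n → Carrier) → ℕ → Carrier
  e         xs zero    = 1#
  e {zero}  xs (suc r) = 0#
  e {suc n} xs (suc r) = xs zero · e (xs ∘ suc) r + e (xs ∘ suc) (suc r)

  -- The factor (-1)^r.
  signed : ℕ → Carrier → Carrier
  signed zero    x = x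
  signed (suc r) x = - signed r x

  signed-cong : ∀ r {x y} → x ≈ y → signed r x ≈ signed r y
  signed-cong zero    x≈y = x≈y
  signed-cong (suc r) x≈y = -‿cong (signed-cong r x≈y)

  signed-0 : ∀ r → signed r 0# ≈ 0#
  signed-0 zero    = ≈-refl
  signed-0 (suc r) = ≈-trans (-‿cong (signed-0 r)) -0#≈0#

  signed-+ : ∀ r x y → signed r (x + y) ≈ signed r x + signed r y
  signed-+ zero    x y = ≈-refl
  signed-+ (suc r) x y = ≈-trans (-‿cong (signed-+ r x y)) (≈-sym (-‿+-comm _ _))

  signed-*ˡ : ∀ r x y → signed r x · y ≈ signed r (x · y)
  signed-*ˡ zero    x y = ≈-refl
  signed-*ˡ (suc r) x y = ≈-trans (≈-sym (-‿distribˡ-* _ y)) (-‿cong (signed-*ˡ r x y))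

  signed-*ʳ : ∀ r x y → x · signed r y ≈ signed r (x · y)
  signed-*ʳ zero    x y = ≈-refl
  signed-*ʳ (suc r) x y = ≈-trans (≈-sym (-‿distribʳ-* x _)) (-‿cong (signed-*ʳ r x y))

  signed-neg : ∀ r x → signed r (- x) ≈ - signed r x
  signed-neg zero    x = ≈-refl
  signed-neg (suc r) x = -‿cong (signed-neg r x)

  signed-even : ∀ k x → signed (k ℕ.* 2) x ≈ x
  signed-even zero    x = ≈-refl
  signed-even (suc k) x = ≈-trans (-‿involutive _) (signed-even k x)

  -- Each monomial of degree r has r factors, and `y` picks up one sign in passing each of them; all
  -- monomials thus get the same sign.
  e-anticomm : ∀ {n} (xs : Fin n → Carrier) y →
               (∀ i → xs i · y ≈ - (y · xs i)) →
               ∀ r → e xs r · y ≈ signed r (y · e xs r)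
  e-anticomm         xs y anti zero    = ≈-trans (*-identityˡ y) (≈-sym (*-identityʳ y))
  e-anticomm {zero}  xs y anti (suc r) = begin
    0# · y               ≈⟨ zeroˡ y ⟩
    0#                   ≈⟨ signed-0 (suc r) ⟨
    signed (suc r) 0#    ≈⟨ signed-cong (suc r) (zeroʳ y) ⟨
    signed (suc r) (y · 0#) ∎
  e-anticomm {suc n} xs y anti (suc r) = begin
    (x · p + p′) · y                                       ≈⟨ distribʳ y _ _ ⟩
    x · p · y + p′ · y                                     ≈⟨ +-cong lemma (e-anticomm (xs ∘ suc) y (anti ∘ suc) (suc r)) ⟩
    signed (suc r) (y · (x · p)) + signed (suc r) (y · p′) ≈⟨ signed-+ (suc r) _ _ ⟨
    signed (suc r) (y · (x · p) + y · p′)                  ≈⟨ signed-cong (suc r) (distribˡ y _ _) ⟨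
    signed (suc r) (y · (x · p + p′))                      ∎
    where
    x  = xs zero
    p  = e (xs ∘ suc) r
    p′ = e (xs ∘ suc) (suc r)
    lemma : x · p · y ≈ signed (suc r) (y · (x · p))
    lemma = begin
      x · p · y                    ≈⟨ *-assoc x p y ⟩
      x · (p · y)                  ≈⟨ *-congˡ (e-anticomm (xs ∘ suc) y (anti ∘ suc) r) ⟩
      x · signed r (y · p)         ≈⟨ signed-*ʳ r x _ ⟩
      signed r (x · (y · p))       ≈⟨ signed-cong r (*-assoc x y p) ⟨
      -- Passing `p` gave r signs; passing `x` gives the last one.
      signed r (x · y · p)         ≈⟨ signed-cong r (*-congʳ (anti zero)) ⟩
      signed r (- (y · x) · p)     ≈⟨ signed-cong r (-‿distribˡ-* _ p) ⟨
      signed r (- (y · x · p))     ≈⟨ signed-neg r _ ⟩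
      signed (suc r) (y · x · p)   ≈⟨ signed-cong (suc r) (*-assoc y x p) ⟩
      signed (suc r) (y · (x · p)) ∎

  ×-zeroʳ : ∀ n → n × 0# ≈ 0#
  ×-zeroʳ zero    = ≈-refl
  ×-zeroʳ (suc n) = ≈-trans (+-identityˡ _) (×-zeroʳ n)

  -- If both arguments are even, two equal binomials cancel. If exactly one is odd, one term on the
  -- left has two odd indices and vanishes. If both are odd, this is Pascal's rule. Multiples of a
  -- ring element `x` are used because the minus sign has no meaning in ℕ.
  a-pascal : ∀ r s x → a r (suc s) × x + signed (suc r) (a (suc r) s × x) ≈ a (suc r) (suc s) × x
  a-pascal r s x with evenOdd r | evenOdd s
  ... | even k | even l
    rewrite a-even-odd k l | a-odd-even k l | a-odd-odd k l =
      ≈-trans (+-congˡ (-‿cong (signed-even k _))) (-‿inverseʳ _)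
  ... | even k | odd l
    rewrite a-even-even k (suc l) | a-odd-odd k l | a-odd-even k (suc l) =
      ≈-trans (+-congˡ (signed-0 (suc (k ℕ.* 2)))) (+-identityʳ _)
  ... | odd k | even l
    rewrite a-odd-odd k l | a-even-even (suc k) l | a-even-odd (suc k) l =
      ≈-trans (+-identityˡ _) (signed-even (suc k) _)
  -- Both terms survive with sign +; `ℕ.+-suc` gives their binomials the common upper index k + l +
  -- 1.
  ... | odd k | odd l
    rewrite a-odd-even k (suc l) | a-even-odd (suc k) l | a-even-even (suc k) (suc l)
          | ℕ.+-suc k l =
      ≈-trans (+-congˡ (signed-even (suc k) _))
        (≈-trans (≈-sym (×-homo-+ x ((suc k ℕ.+ l) C k) _))
                 (×-congˡ (nCk+nC[k+1]≡[n+1]C[k+1] (suc k ℕ.+ l) k)))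

  -- The induction on n treats all degrees at once, since the step at (r+1, s+1) calls on the tail
  -- at (r, s+1), (r+1, s) and (r+1, s+1). The coefficient is a natural multiple, which makes sense
  -- in any ring.
  e-* : ∀ {n} (xs : Fin n → Carrier) →
        (∀ {i j} → i ≢ j → xs i · xs j ≈ - (xs j · xs i)) →
        (∀ i → xs i · xs i ≈ 0#) →
        ∀ r s → e xs r · e xs s ≈ a r s × e xs (r ℕ.+ s)
  e-* xs anti square zero s = ≈-trans (*-identityˡ _) (≈-sym (×-homo-1 _))
  e-* xs anti square r@(suc _) zero
    rewrite a-zeroʳ r | ℕ.+-identityʳ r = ≈-trans (*-identityʳ _) (≈-sym (×-homo-1 _))
  e-* {zero} xs anti square (suc r) (suc s) = ≈-trans (zeroˡ 0#) (≈-sym (×-zeroʳ (a (suc r) (suc s))))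
  e-* {suc n} xs anti square (suc r) (suc s) = begin
    (x · p + p′) · (x · q + q′)
      ≈⟨ ≈-trans (distribʳ _ _ _) (+-cong (distribˡ _ _ _) (distribˡ _ _ _)) ⟩
    (x · p · (x · q) + x · p · q′) + (p′ · (x · q) + p′ · q′)
      ≈⟨ +-cong (≈-trans (+-congʳ xpxq≈0) (+-identityˡ _)) ≈-refl ⟩
    x · p · q′ + (p′ · (x · q) + p′ · q′)
      ≈⟨ +-assoc _ _ _ ⟨
    (x · p · q′ + p′ · (x · q)) + p′ · q′
      ≈⟨ +-cong (+-cong xpq′ p′xq) (ih (suc r) (suc s)) ⟩
    (a r (suc s) × y + signed (suc r) (a (suc r) s × y)) + a (suc r) (suc s) × e xs′ (suc r ℕ.+ suc s)
      ≈⟨ +-congʳ (a-pascal r s y) ⟩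
    a (suc r) (suc s) × y + a (suc r) (suc s) × e xs′ (suc r ℕ.+ suc s)
      ≈⟨ ×-distrib-+ _ _ (a (suc r) (suc s)) ⟨
    a (suc r) (suc s) × (y + e xs′ (suc r ℕ.+ suc s)) ∎
    where
    x   = xs zero
    xs′ = xs ∘ suc
    p   = e xs′ r
    p′  = e xs′ (suc r)
    q   = e xs′ s
    q′  = e xs′ (suc s)
    -- Both mixed terms are multiples of `y`. The index is written so that `e xs (suc r ℕ.+ suc s)`
    -- unfolds to `y` plus the part free of `x`.
    y   = x · e xs′ (r ℕ.+ suc s)

    ih : ∀ r s → e xs′ r · e xs′ s ≈ a r s × e xs′ (r ℕ.+ s)
    ih = e-* xs′ (λ i≢j → anti (i≢j ∘ suc-injective)) (square ∘ suc)

    commute : ∀ r → e xs′ r · x ≈ signed r (x · e xs′ r)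
    commute = e-anticomm xs′ x (λ i → anti {suc i} {zero} λ ())

    xpxq≈0 : x · p · (x · q) ≈ 0#
    xpxq≈0 = begin
      x · p · (x · q)              ≈⟨ *-assoc _ x q ⟨
      x · p · x · q                ≈⟨ *-congʳ (*-assoc x p x) ⟩
      x · (p · x) · q              ≈⟨ *-congʳ (*-congˡ (commute r)) ⟩
      x · signed r (x · p) · q     ≈⟨ *-congʳ (signed-*ʳ r x _) ⟩
      signed r (x · (x · p)) · q   ≈⟨ *-congʳ (signed-cong r (*-assoc x x p)) ⟨
      signed r (x · x · p) · q     ≈⟨ *-congʳ (signed-cong r (*-congʳ (square zero))) ⟩
      signed r (0# · p) · q        ≈⟨ *-congʳ (signed-cong r (zeroˡ p)) ⟩
      signed r 0# · q              ≈⟨ *-congʳ (signed-0 r) ⟩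
      0# · q                       ≈⟨ zeroˡ q ⟩
      0#                           ∎

    xpq′ : x · p · q′ ≈ a r (suc s) × y
    xpq′ = begin
      x · p · q′                               ≈⟨ *-assoc x p q′ ⟩
      x · (p · q′)                             ≈⟨ *-congˡ (ih r (suc s)) ⟩
      x · (a r (suc s) × e xs′ (r ℕ.+ suc s))  ≈⟨ ×-comm-* (a r (suc s)) x _ ⟩
      a r (suc s) × y                          ∎

    p′xq : p′ · (x · q) ≈ signed (suc r) (a (suc r) s × y)
    p′xq = begin
      p′ · (x · q)                    ≈⟨ *-assoc p′ x q ⟨
      -- Moving `x` across a factor of degree r+1 is the source of the sign in `a-pascal`.
      p′ · x · q                      ≈⟨ *-congʳ (commute (suc r)) ⟩
      signed (suc r) (x · p′) · q     ≈⟨ signed-*ˡ (suc r) _ q ⟩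
      signed (suc r) (x · p′ · q)     ≈⟨ signed-cong (suc r) (*-assoc x p′ q) ⟩
      signed (suc r) (x · (p′ · q))   ≈⟨ signed-cong (suc r) (*-congˡ (ih (suc r) s)) ⟩
      signed (suc r) (x · (a (suc r) s × e xs′ (suc r ℕ.+ s)))
        ≈⟨ signed-cong (suc r) (×-comm-* (a (suc r) s) x _) ⟩
      signed (suc r) (a (suc r) s × (x · e xs′ (suc r ℕ.+ s)))
        ≡⟨ cong (λ m → signed (suc r) (a (suc r) s × (x · e xs′ m))) (ℕ.+-suc r s) ⟨
      signed (suc r) (a (suc r) s × y) ∎

-- Subsets of a given size, split by their first element.

filter-map : ∀ {a b p} {A : Set a} {B : Set b} {P : Pred B p} (P? : Decidable P) (f : A → B) xs →
             filter P? (map f xs) ≡ map f (filter (P? ∘ f) xs)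
filter-map P? f []       = refl
filter-map P? f (x ∷ xs) with P? (f x)
... | yes _ = cong (f x ∷_) (filter-map P? f xs)
... | no  _ = filter-map P? f xs

-- `suc i` lies in `b ∷ A` exactly when `i` lies in `A`, whatever `b` is.
filter-allFin-suc : ∀ {n} b (A : Subset n) →
  filter (_∈? (b Vec.∷ A)) (map suc (allFin n)) ≡ map suc (filter (_∈? A) (allFin n))
filter-allFin-suc {n} b A = trans (filter-map (_∈? (b Vec.∷ A)) suc (allFin n))
  (cong (map suc) (filter-≐ _ (_∈? A) (drop-there , there) (allFin n)))

subsetsOfSize : ∀ n → ℕ → List (Subset n)
subsetsOfSize n r = filter (λ A → ∣ A ∣ ℕ.≟ r) (subsets n)

-- This is the counterpart for lists of subsets of the recursion defining `e`: a set containing the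
-- first element needs r further ones.
subsetsOfSize-suc : ∀ n r → subsetsOfSize (suc n) (suc r) ≡
  map (inside Vec.∷_) (subsetsOfSize n r) ++ map (outside Vec.∷_) (subsetsOfSize n (suc r))
subsetsOfSize-suc n r = trans (filter-++ _ (map (inside Vec.∷_) (subsets n)) _) (cong₂ _++_
  (trans (filter-map _ (inside Vec.∷_) (subsets n))
    (cong (map _) (filter-≐ _ _ (ℕ.suc-injective , cong suc) (subsets n))))
  (filter-map _ (outside Vec.∷_) (subsets n)))

subsetsOfSize-zero : ∀ n →
  subsetsOfSize (suc n) 0 ≡ map (outside Vec.∷_) (subsetsOfSize n 0)
subsetsOfSize-zero n = trans (filter-++ _ (map (inside Vec.∷_) (subsets n)) _) (cong₂ _++_
  (trans (filter-map _ (inside Vec.∷_) (subsets n))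
    (cong (map _) (filter-none _ (universal (λ _ ()) (subsets n)))))
  (filter-map _ (outside Vec.∷_) (subsets n)))

-- Identification of `F` with `e` and of rational scalars with multiples.

module _ {m : ℕ} where
  open Ring (R m) hiding (zero) renaming (_*_ to _·_; refl to ≈-refl; sym to ≈-sym; trans to ≈-trans)
  open SemiringMult semiring using (_×_)
  open ElementarySymmetric (R m)
  open SetoidReasoning setoid

  -- Generalises `θ[_]` to families whose length n is independent of m, so that n can shrink while
  -- the ring `R m` stays fixed.
  monomial : ∀ {n} → (Fin n → Expr m) → Subset n → Expr m
  monomial {n} xs A = product (map xs (filter (_∈? A) (allFin n)))

  -- `allFin (suc n)` unfolds to `zero ∷ tabulate suc`; this handles what remains once `b` has
  -- decided the membership of `zero`.
  map-filter-suc : ∀ {n} (xs : Fin (suc n) → Expr m) b (A : Subset n) →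
    map xs (filter (_∈? (b Vec.∷ A)) (tabulate suc)) ≡
    map (xs ∘ suc) (filter (_∈? A) (allFin n))
  map-filter-suc {n} xs b A =
    trans (cong (map xs ∘ filter (_∈? (b Vec.∷ A))) (≡.sym (map-tabulate id suc)))
      (trans (cong (map xs) (filter-allFin-suc b A)) (≡.sym (map-∘ _)))

  monomial-inside : ∀ {n} (xs : Fin (suc n) → Expr m) A →
    monomial xs (inside Vec.∷ A) ≡ xs zero · monomial (xs ∘ suc) A
  monomial-inside xs A = cong (λ ys → xs zero · product ys) (map-filter-suc xs inside A)

  monomial-outside : ∀ {n} (xs : Fin (suc n) → Expr m) A →
    monomial xs (outside Vec.∷ A) ≡ monomial (xs ∘ suc) A
  monomial-outside xs A = cong product (map-filter-suc xs outside A)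

  sum-++ : ∀ (xs ys : List (Expr m)) → sum (xs ++ ys) ≈ sum xs + sum ys
  sum-++ []       ys = ≈-sym (+-identityˡ _)
  sum-++ (x ∷ xs) ys = ≈-trans (+-congˡ (sum-++ xs ys)) (≈-sym (+-assoc _ _ _))

  sum-*ˡ : ∀ x (ys : List (Expr m)) → sum (map (x ·_) ys) ≈ x · sum ys
  sum-*ˡ x []       = ≈-sym (zeroʳ x)
  sum-*ˡ x (y ∷ ys) = ≈-trans (+-congˡ (sum-*ˡ x ys)) (≈-sym (distribˡ x y _))

  map-monomial-outside : ∀ {n} (xs : Fin (suc n) → Expr m) As →
    map (monomial xs) (map (outside Vec.∷_) As) ≡ map (monomial (xs ∘ suc)) As
  map-monomial-outside xs As = trans (≡.sym (map-∘ As)) (map-cong (monomial-outside xs) As)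

  map-monomial-inside : ∀ {n} (xs : Fin (suc n) → Expr m) As →
    map (monomial xs) (map (inside Vec.∷_) As) ≡ map (xs zero ·_) (map (monomial (xs ∘ suc)) As)
  map-monomial-inside xs As = trans (≡.sym (map-∘ As)) (trans (map-cong (monomial-inside xs) As) (map-∘ As))

  -- Both sides satisfy the same recursion: sets containing the first index contribute the multiple
  -- of `xs zero`, the others the second summand.
  sum-monomials : ∀ {n} (xs : Fin n → Expr m) r →
    sum (map (monomial xs) (subsetsOfSize n r)) ≈ e xs r
  sum-monomials {zero}  xs zero    = +-identityʳ _
  sum-monomials {zero}  xs (suc r) = ≈-refl
  sum-monomials {suc n} xs zero
    rewrite subsetsOfSize-zero n | map-monomial-outside xs (subsetsOfSize n 0) =
      sum-monomials (xs ∘ suc) 0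
  sum-monomials {suc n} xs (suc r) = begin
    sum (map (monomial xs) (subsetsOfSize (suc n) (suc r)))
      ≡⟨ cong sum (trans (cong (map (monomial xs)) (subsetsOfSize-suc n r))
           (trans (map-++ (monomial xs) (map (inside Vec.∷_) (subsetsOfSize n r)) _)
             (cong₂ _++_ (map-monomial-inside xs (subsetsOfSize n r)) (map-monomial-outside xs (subsetsOfSize n (suc r)))))) ⟩
    sum (map (xs zero ·_) (monomials r) ++ monomials (suc r))
      ≈⟨ sum-++ (map (xs zero ·_) (monomials r)) _ ⟩
    sum (map (xs zero ·_) (monomials r)) + sum (monomials (suc r))
      ≈⟨ +-congʳ (sum-*ˡ (xs zero) (monomials r)) ⟩
    xs zero · sum (monomials r) + sum (monomials (suc r))
      ≈⟨ +-cong (*-congˡ (sum-monomials (xs ∘ suc) r)) (sum-monomials (xs ∘ suc) (suc r)) ⟩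
    e xs (suc r) ∎
    where
    monomials : ℕ → List (Expr m)
    monomials r = map (monomial (xs ∘ suc)) (subsetsOfSize n r)

  -- Links the rational scalar in the theorem with the natural multiple in `e-*`.
  fromℕ-* : ∀ k x → fromℕ k · x ≈ k × x
  fromℕ-* zero    x = zeroˡ x
  fromℕ-* (suc k) x = begin
    fromℕ (suc k) · x             ≡⟨ cong (λ q → con q · x) (/1-suc k) ⟩
    con (ℚ.1ℚ ℚ.+ + k ℚ./ 1) · x  ≈⟨ *-congʳ (con-+ ℚ.1ℚ _) ⟩
    (1# + fromℕ k) · x            ≈⟨ distribʳ x _ _ ⟩
    1# · x + fromℕ k · x          ≈⟨ +-cong (*-identityˡ x) (fromℕ-* k x) ⟩
    suc k × x                     ∎
    where
    /1-suc : ∀ k → + suc k ℚ./ 1 ≡ ℚ.1ℚ ℚ.+ + k ℚ./ 1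
    -- For a variable `k` the fraction is stuck on its normalisation. Coprimality of k and 1 exposes
    -- the reduced form, after which rational addition computes to (1 + k * 1) / 1.
    /1-suc k rewrite ℚ.normalize-coprime (coprime-sym (1-coprimeTo k)) =
      cong (λ j → (+ 1 ℤ.+ j) ℚ./ 1) (≡.sym (ℤ.*-identityʳ (+ k)))

proposition2p3 : ∀ (n : ℕ) → n ℕ.≥ 1 → ∀ (r s : ℕ) →
    let open Ring (R n) in
    F n r * F n s ≈ fromℕ (a r s) * F n (r ℕ.+ s)
proposition2p3 n _ r s = begin
  -- `θ[_]` and `monomial θ` unfold to the same expression, so `sum-monomials θ` applies to `F`
  -- directly.
  F n r · F n s                 ≈⟨ *-cong (sum-monomials θ r) (sum-monomials θ s) ⟩
  e θ r · e θ s                 ≈⟨ e-* θ θ-anticomm θ-square r s ⟩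
  a r s × e θ (r ℕ.+ s)         ≈⟨ fromℕ-* (a r s) _ ⟨
  fromℕ (a r s) · e θ (r ℕ.+ s) ≈⟨ *-congˡ (sum-monomials θ (r ℕ.+ s)) ⟨
  fromℕ (a r s) · F n (r ℕ.+ s) ∎
  where
  open Ring (R n) using (setoid; semiring; *-cong; *-congˡ) renaming (_*_ to _·_)
  open SemiringMult semiring using (_×_)
  open ElementarySymmetric (R n)
  open SetoidReasoning setoid
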